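{- Let $k$ be an integer with $k \ge 2$, and let $G$ be a graph with precisely two connected components, one of which is trivial. Then $G$ is a cograph minimal $(\infty,k)$-polar obstruction if and only if $G \cong K_1 + (K_1 \oplus H')$, where $H'$ is a disconnected cograph minimal $(\infty,k-1)$-polar obstruction that is $(1,k)$-polar.
   Context: All graphs are finite and simple. A cograph is a graph with no induced subgraph isomorphic to $P_4$. $G+H$ denotes disjoint union and $G \oplus H$ the join (disjoint union plus all edges between $G$ and $H$). A component is trivial if it is isomorphic to $K_1$. A cluster is a disjoint union of complete graphs. For $s,k \in \mathbb{Z}_{\ge 0}\cup\{\infty\}$, an $(s,k)$-polar partition of $G$ is a partition $(A,B)$ of $V(G)$ (parts may be empty) such that $G[A]$ is a complete multipartite graph with at most $s$ parts and $G[B]$ is a cluster with at most $k$ components; $\infty$ means unbounded. $G$ is $(s,k)$-polar if it has such a partition. A cograph minimal $(s,k)$-polar obstruction is a cograph that is not $(s,k)$-polar but all of whose proper induced subgraphs are $(s,k)$-polar. -}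

module Defs where

open import Data.Nat using (ℕ; zero; suc; _+_; _<_; _≤_)
open import Data.Fin using (Fin; splitAt; _↑ˡ_; _↑ʳ_)
open import Data.Fin.Properties using (splitAt-↑ˡ; splitAt-↑ʳ)
open import Data.Bool using (Bool; true; false; T)
open import Data.Sum using (_⊎_; inj₁; inj₂)
open import Data.Product using (Σ; ∃; ∃-syntax; _×_; _,_)
open import Data.Empty using (⊥)
open import Relation.Nullary using (¬_)
open import Relation.Binary.PropositionalEquality using (_≡_; _≢_; refl)
open import Function.Bundles using (_↣_; _↔_; Injection; Inverse)

record Graph : Set where
  field
    n      : ℕ
    adj    : Fin n → Fin n → Bool
    sym    : ∀ i j → adj i j ≡ adj j i
    irrefl : ∀ i → adj i i ≡ false

open Graph public

V : Graph → Set
V G = Fin (n G)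

Adj : (G : Graph) → V G → V G → Set
Adj G x y = adj G x y ≡ true

induced : (G : Graph) {m : ℕ} → Fin m ↣ V G → Graph
induced G {m} f = record
  { n = m
  ; adj = λ i j → adj G (to i) (to j)
  ; sym = λ i j → sym G (to i) (to j)
  ; irrefl = λ i → irrefl G (to i)
  }
  where open Injection f

_≅_ : Graph → Graph → Set
G ≅ H = Σ (V G ↔ V H) λ φ →
  ∀ x y → adj H (Inverse.to φ x) (Inverse.to φ y) ≡ adj G x y

private
  comb : ∀ {m k} → (Fin m → Fin m → Bool) → (Fin k → Fin k → Bool) → Bool →
         Fin m ⊎ Fin k → Fin m ⊎ Fin k → Bool
  comb a b c (inj₁ x) (inj₁ y) = a x y
  comb a b c (inj₂ x) (inj₂ y) = b x y
  comb a b c (inj₁ x) (inj₂ y) = c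
  comb a b c (inj₂ x) (inj₁ y) = c

  comb-sym : ∀ {m k} (a : Fin m → Fin m → Bool) (b : Fin k → Fin k → Bool) c →
             (∀ i j → a i j ≡ a j i) → (∀ i j → b i j ≡ b j i) →
             ∀ u v → comb a b c u v ≡ comb a b c v u
  comb-sym a b c sa sb (inj₁ x) (inj₁ y) = sa x y
  comb-sym a b c sa sb (inj₂ x) (inj₂ y) = sb x y
  comb-sym a b c sa sb (inj₁ x) (inj₂ y) = refl
  comb-sym a b c sa sb (inj₂ x) (inj₁ y) = refl

  comb-irr : ∀ {m k} (a : Fin m → Fin m → Bool) (b : Fin k → Fin k → Bool) c →
             (∀ i → a i i ≡ false) → (∀ i → b i i ≡ false) →
             ∀ u → comb a b c u u ≡ false
  comb-irr a b c ia ib (inj₁ x) = ia x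
  comb-irr a b c ia ib (inj₂ x) = ib x

  combine : Graph → Graph → Bool → Graph
  combine G H c = record
    { n = n G + n H
    ; adj = λ i j → comb (adj G) (adj H) c (splitAt (n G) i) (splitAt (n G) j)
    ; sym = λ i j → comb-sym (adj G) (adj H) c (sym G) (sym H)
                      (splitAt (n G) i) (splitAt (n G) j)
    ; irrefl = λ i → comb-irr (adj G) (adj H) c (irrefl G) (irrefl H)
                      (splitAt (n G) i)
    }

_+ᴳ_ : Graph → Graph → Graph
G +ᴳ H = combine G H false

_⊕_ : Graph → Graph → Graph
G ⊕ H = combine G H true

K₁ : Graph
K₁ = record { n = 1 ; adj = λ _ _ → false ; sym = λ _ _ → refl ; irrefl = λ _ → refl }

data Reach (G : Graph) : V G → V G → Set where
  here : ∀ {x} → Reach G x x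
  step : ∀ {x y z} → Adj G x y → Reach G y z → Reach G x z

Connected : Graph → Set
Connected G = ∀ x y → Reach G x y

Disconnected : Graph → Set
Disconnected G = ∃[ x ] ∃[ y ] ¬ Reach G x y

-- G has precisely two connected components, one of which is trivial (K₁):
-- some vertex v is isolated (so {v} is a trivial component), there is a
-- vertex other than v, and all vertices other than v are mutually
-- reachable (so they form exactly one further component).
TwoComponentsOneTrivial : Graph → Set
TwoComponentsOneTrivial G = ∃[ v ]
  ((∀ y → adj G v y ≡ false)
  × (∃[ x ] x ≢ v)
  × (∀ x y → x ≢ v → y ≢ v → Reach G x y))

P₄adj : Fin 4 → Fin 4 → Bool
P₄adj Fin.zero (Fin.suc Fin.zero) = true
P₄adj (Fin.suc Fin.zero) Fin.zero = true
P₄adj (Fin.suc Fin.zero) (Fin.suc (Fin.suc Fin.zero)) = true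
P₄adj (Fin.suc (Fin.suc Fin.zero)) (Fin.suc Fin.zero) = true
P₄adj (Fin.suc (Fin.suc Fin.zero)) (Fin.suc (Fin.suc (Fin.suc Fin.zero))) = true
P₄adj (Fin.suc (Fin.suc (Fin.suc Fin.zero))) (Fin.suc (Fin.suc Fin.zero)) = true
P₄adj _ _ = false

-- No induced subgraph isomorphic to P₄ (equivalently: no injection of
-- Fin 4 into V G whose induced adjacency is exactly that of P₄; an
-- isomorphism onto P₄ can be composed into such a labelling).
Cograph : Graph → Set
Cograph G = ¬ (Σ (Fin 4 ↣ V G) λ f →
  ∀ i j → adj G (Injection.to f i) (Injection.to f j) ≡ P₄adj i j)

data ℕ∞ : Set where
  fin : ℕ → ℕ∞
  ∞   : ℕ∞

Labels : ℕ∞ → Set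
Labels (fin s) = Fin s
Labels ∞       = ℕ

-- G[A] is complete multipartite with at most s parts, where A = {x | inA x ≡ true}:
-- there is an assignment of the vertices of A to at most s parts such that two
-- distinct vertices of A are adjacent iff they lie in different parts.
CompleteMultipartiteOn : (G : Graph) → ℕ∞ → (V G → Bool) → Set
CompleteMultipartiteOn G s inA = Σ (V G → Labels s) λ c →
  ∀ x y → inA x ≡ true → inA y ≡ true → x ≢ y →
    (Adj G x y → c x ≢ c y) × (c x ≢ c y → Adj G x y)

-- G[B] is a cluster with at most k components, B = {x | inA x ≡ false}:
-- two distinct vertices of B are adjacent iff they have the same label.
ClusterOn : (G : Graph) → ℕ∞ → (V G → Bool) → Set
ClusterOn G k inA = Σ (V G → Labels k) λ d →
  ∀ x y → inA x ≡ false → inA y ≡ false → x ≢ y →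
    (Adj G x y → d x ≡ d y) × (d x ≡ d y → Adj G x y)

Polar : ℕ∞ → ℕ∞ → Graph → Set
Polar s k G = Σ (V G → Bool) λ inA →
  CompleteMultipartiteOn G s inA × ClusterOn G k inA

MinimalObstruction : ℕ∞ → ℕ∞ → Graph → Set
MinimalObstruction s k G =
  ¬ Polar s k G ×
  (∀ {m} (f : Fin m ↣ V G) → m < n G → Polar s k (induced G f))

CographMinimalObstruction : ℕ∞ → ℕ∞ → Graph → Set
CographMinimalObstruction s k G = Cograph G × MinimalObstruction s k G

{-# OPTIONS --safe #-}
module Submission where

open import Defs
open import Data.Nat using (ℕ; _≤_; _∸_)
open import Data.Product using (Σ; ∃-syntax; _×_)
open import Function.Bundles using (_⇔_)

open import Axiom.UniquenessOfIdentityProofs.WithK using (uip)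
open import Data.Bool using (Bool; true; false; not)
open import Data.Bool.Properties using (¬-not; not-¬)
import Data.Bool.Properties as Bool
open import Data.Empty using (⊥)
open import Data.Fin using (Fin; zero; suc; toℕ; punchIn; punchOut)
open import Data.Fin.Patterns using (0F; 1F; 2F; 3F)
open import Data.Fin.Permutation using (insert; lift₀; _∘ₚ_)
import Data.Fin.Permutation as Perm
open import Data.Fin.Properties using (_≟_; toℕ-injective; suc-injective; punchIn-injective; punchInᵢ≢i; punchOut-injective; punchIn-punchOut; any?; ¬∀⟶∃¬; injective⇒≤)
open import Data.Maybe using (Maybe; just; nothing)
open import Data.Maybe.Properties using (just-injective)
open import Data.Nat using (zero; suc; _<_; _*_; s≤s)
import Data.Nat.Properties as ℕ
open import Data.Product using (_,_; proj₁; proj₂)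
open import Data.Sum using (_⊎_; inj₁; inj₂)
open import Data.Vec.Functional using (_∷_; []; insertAt)
open import Data.Vec.Functional.Properties using (insertAt-lookup; insertAt-punchIn)
open import Function using (_∘_; _on_)
open import Function.Bundles using (_↣_; _↔_; mk↣; mk⇔; Injection; Inverse)
open import Function.Construct.Symmetry using (↔-sym)
open import Function.Definitions using (Injective)
open import Function.Properties.Inverse using (↔⇒↣)
open import Relation.Binary.PropositionalEquality using (_≡_; _≢_; refl; trans; cong; cong₂) renaming (sym to ≡-sym)
open import Relation.Nullary using (¬_; Dec; yes; no; contradiction)
open import Relation.Nullary.Decidable using (does; _×-dec_; ¬?; decidable-stable)

-- K₁ + H is (∞,k)-polar iff H is (∞,k-1)-polar or (1,k)-polar; and if
-- K₁ ⊕ H′ is (∞,k-1)- or (1,k)-polar, then H′ is (∞,k-1)-polar (k ≥ 2).  These two facts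
-- give the backward direction.  Forwards, let G = K₁ + H be a minimal obstruction and let
-- (A, B) be an (∞,k)-polar partition of H.  B contains non-adjacent vertices, as H is not
-- (∞,k-1)-polar.  Hence whenever H is a join of two non-empty graphs, B lies in one of them,
-- H₁ say, and the other, being contained in A, is complete multipartite.  So H₁ is not
-- (∞,k-1)-polar, and for any x outside H₁ already K₁ + (x ⊕ H₁) is an obstruction, hence
-- equal to G.  Thus every join decomposition of H is of the form x ⊕ H₁; the connected
-- cograph H has one, and H₁, not being a join itself, is disconnected.

-- Polar partitions of adjacency functions

Adjacency : Set → Set
Adjacency X = X → X → Bool

-- Polar s k G is definitionally PolarAdj s k (adj G).
PolarAdj : ℕ∞ → ℕ∞ → {X : Set} → Adjacency X → Set
PolarAdj s k {X} a = Σ (X → Bool) λ inA →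
  (Σ (X → Labels s) λ c →
    ∀ x y → inA x ≡ true → inA y ≡ true → x ≢ y →
      (a x y ≡ true → c x ≢ c y) × (c x ≢ c y → a x y ≡ true)) ×
  (Σ (X → Labels k) λ d →
    ∀ x y → inA x ≡ false → inA y ≡ false → x ≢ y →
      (a x y ≡ true → d x ≡ d y) × (d x ≡ d y → a x y ≡ true))

false≢true : false ≢ true
false≢true ()

-- Vertex types are arbitrary, so that induced subgraphs can later be indexed by `Maybe` and `Σ`
-- types without renumbering.
polar-embed : ∀ {s k} {X Y : Set} {a : Adjacency X} {b : Adjacency Y} (f : Y → X) →
  Injective _≡_ _≡_ f → (∀ x y → a (f x) (f y) ≡ b x y) →
  PolarAdj s k a → PolarAdj s k b
polar-embed f inj e (inA , (c , C) , (d , D)) =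
  inA ∘ f ,
  (c ∘ f , λ x y ix iy x≢y → let (p , q) = C (f x) (f y) ix iy (x≢y ∘ inj) in
     p ∘ trans (e x y) , trans (≡-sym (e x y)) ∘ q) ,
  (d ∘ f , λ x y ix iy x≢y → let (p , q) = D (f x) (f y) ix iy (x≢y ∘ inj) in
     p ∘ trans (e x y) , trans (≡-sym (e x y)) ∘ q)

polar-restrict : ∀ {s k} {X Y : Set} {a : Adjacency X} (f : Y → X) →
  Injective _≡_ _≡_ f → PolarAdj s k a → PolarAdj s k (a on f)
polar-restrict f inj = polar-embed f inj (λ _ _ → refl)

polar-weaken : ∀ {s k} {X : Set} {a : Adjacency X} →
  PolarAdj (fin s) k a → PolarAdj ∞ k a
polar-weaken (inA , (c , C) , D) =
  inA , (toℕ ∘ c , λ x y ix iy x≢y → let (p , q) = C x y ix iy x≢y in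
     (λ xy e → p xy (toℕ-injective e)) , λ ne → q (ne ∘ cong toℕ)) , D

-- Like punchOut i, with junk value zero at i itself.
drop-label : ∀ {j} → Fin (suc (suc j)) → Fin (suc (suc j)) → Fin (suc j)
drop-label i l with i ≟ l
... | yes _  = zero
... | no i≢l = punchOut i≢l

drop-label-injective : ∀ {j} {i l l′ : Fin (suc (suc j))} → i ≢ l → i ≢ l′ →
  drop-label i l ≡ drop-label i l′ → l ≡ l′
drop-label-injective {i = i} {l} {l′} i≢l i≢l′ e with i ≟ l | i ≟ l′
... | yes p | _     = contradiction p i≢l
... | no _  | yes q = contradiction q i≢l′
... | no p  | no q  = punchOut-injective p q e

Fin1-unique : (i j : Fin 1) → i ≡ j
Fin1-unique zero zero = refl

-- Adding an isolated or a dominating vertex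

isolated-split : ∀ {j} {X Y : Set} {a : Adjacency Y} (v : Y) (f : X → Y) →
  Injective _≡_ _≡_ f → (∀ x → v ≢ f x) → (∀ x → a v (f x) ≡ false) →
  PolarAdj ∞ (fin (suc (suc j))) a →
  PolarAdj ∞ (fin (suc j)) (a on f) ⊎ PolarAdj (fin 1) (fin (suc (suc j))) (a on f)
isolated-split {a = a} v f inj v≢f iso (inA , (c , C) , (d , D)) with inA v in inA-v
... | false = inj₁
  (inA ∘ f ,
  (c ∘ f , λ x y ix iy x≢y → C (f x) (f y) ix iy (x≢y ∘ inj)) ,
  (drop-label (d v) ∘ d ∘ f , λ x y ix iy x≢y →
    let (p , q) = D (f x) (f y) ix iy (x≢y ∘ inj) in
    cong (drop-label (d v)) ∘ p , q ∘ drop-label-injective (new x ix) (new y iy)))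
  where
  new : ∀ x → inA (f x) ≡ false → d v ≢ d (f x)
  new x ix e = false≢true (trans (≡-sym (iso x)) (proj₂ (D v (f x) inA-v ix (v≢f x)) e))
... | true = inj₂
  (inA ∘ f ,
  ((λ _ → zero) , λ x y ix iy x≢y →
    (λ xy → contradiction (trans (≡-sym (same x ix)) (same y iy))
                          (proj₁ (C (f x) (f y) ix iy (x≢y ∘ inj)) xy)) ,
    λ 0≢0 → contradiction refl 0≢0) ,
  (d ∘ f , λ x y ix iy x≢y → D (f x) (f y) ix iy (x≢y ∘ inj)))
  where
  same : ∀ x → inA (f x) ≡ true → c v ≡ c (f x)
  same x ix = decidable-stable (c v ℕ.≟ c (f x)) λ ne →
    false≢true (trans (≡-sym (iso x)) (proj₂ (C v (f x) inA-v ix (v≢f x)) ne))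

-- If the dominating vertex lies in A, the rest is a cluster, and moving one of its
-- cliques to the multipartite side saves a component; if it lies in B, the rest is split.
dominating-split : ∀ {j} {X Y : Set} {a : Adjacency Y} (v : Y) (f : X → Y) →
  Injective _≡_ _≡_ f → (∀ x → v ≢ f x) → (∀ x → a v (f x) ≡ true) →
  (e : X → ℕ) → Injective _≡_ _≡_ e →
  PolarAdj (fin 1) (fin (suc (suc j))) a → PolarAdj ∞ (fin (suc j)) (a on f)
dominating-split {j} {X} {a = a} v f inj v≢f dom e e-inj (inA , (c , C) , (d , D)) with inA v in inA-v
... | true =
  (λ x → does (zero ≟ d (f x))) ,
  -- The clique moved to A is complete multipartite with singleton parts, hence the injective labels
  -- `e`.
  (e , λ x y ix iy x≢y →
    (λ _ → x≢y ∘ e-inj) ,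
    λ _ → proj₂ (cluster x y x≢y) (trans (≡-sym (first x ix)) (first y iy))) ,
  (drop-label zero ∘ d ∘ f , λ x y ix iy x≢y →
    let (p , q) = cluster x y x≢y in
    cong (drop-label zero) ∘ p , q ∘ drop-label-injective (other x ix) (other y iy))
  where
  inB : ∀ x → inA (f x) ≡ false
  inB x = ¬-not λ ix → proj₁ (C v (f x) inA-v ix (v≢f x)) (dom x) (Fin1-unique _ _)

  cluster : ∀ x y → x ≢ y →
    (a (f x) (f y) ≡ true → d (f x) ≡ d (f y)) × (d (f x) ≡ d (f y) → a (f x) (f y) ≡ true)
  cluster x y x≢y = D (f x) (f y) (inB x) (inB y) (x≢y ∘ inj)

  first : ∀ x → does (zero ≟ d (f x)) ≡ true → zero ≡ d (f x)
  first x ix with zero ≟ d (f x)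
  ... | yes z = z

  other : ∀ x → does (zero ≟ d (f x)) ≡ false → zero ≢ d (f x)
  other x ix with zero ≟ d (f x)
  ... | no nz = nz
... | false =
  inA ∘ f ,
  ((λ _ → 0) , λ x y ix iy x≢y →
    (λ xy → contradiction (Fin1-unique _ _) (proj₁ (C (f x) (f y) ix iy (x≢y ∘ inj)) xy)) ,
    λ 0≢0 → contradiction refl 0≢0) ,
  -- Every vertex of B is adjacent to `v`, so B is a single clique and one label is enough.
  ((λ _ → zero) , λ x y ix iy x≢y →
    (λ _ → refl) ,
    λ _ → proj₂ (D (f x) (f y) ix iy (x≢y ∘ inj)) (trans (≡-sym (same x ix)) (same y iy)))
  where
  same : ∀ x → inA (f x) ≡ false → d v ≡ d (f x)
  same x ix = proj₁ (D v (f x) inA-v ix (v≢f x)) (dom x)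

module _ {n : ℕ} {a : Adjacency (Fin (suc n))} (a-sym : ∀ x y → a x y ≡ a y x) where

  isolated-into-B : ∀ {k} → (∀ i → a zero (suc i) ≡ false) →
    PolarAdj ∞ (fin k) (a on suc) → PolarAdj ∞ (fin (suc k)) a
  isolated-into-B iso (inA , (c , C) , (d , D)) =
    false ∷ inA , (0 ∷ c , C′) , (zero ∷ (suc ∘ d) , D′)
    where
    C′ : ∀ x y → _ → _ → _ → _
    C′ (suc x) (suc y) ix iy x≢y = C x y ix iy (x≢y ∘ cong suc)
    D′ : ∀ x y → _ → _ → _ → _
    D′ zero zero _ _ 0≢0 = contradiction refl 0≢0
    D′ zero (suc y) _ _ _ = (λ e → contradiction (trans (≡-sym (iso y)) e) false≢true) , λ ()
    D′ (suc x) zero _ _ _ =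
      (λ e → contradiction (trans (≡-sym (trans (a-sym (suc x) zero) (iso x))) e) false≢true) , λ ()
    D′ (suc x) (suc y) ix iy x≢y = let (p , q) = D x y ix iy (x≢y ∘ cong suc) in
      cong suc ∘ p , q ∘ suc-injective

  isolated-into-A : ∀ {k} → (∀ i → a zero (suc i) ≡ false) →
    PolarAdj (fin 1) (fin (suc k)) (a on suc) → PolarAdj ∞ (fin (suc k)) a
  isolated-into-A iso (inA , (c , C) , (d , D)) =
    -- A has at most one part, so it is independent and can absorb vertex 0. The cluster label
    -- `zero` given to vertex 0 is arbitrary.
    true ∷ inA , ((λ _ → 0) , C′) , (zero ∷ d , D′)
    where
    C′ : ∀ x y → _ → _ → _ → _
    C′ zero zero _ _ 0≢0 = contradiction refl 0≢0
    C′ zero (suc y) _ _ _ =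
      (λ e → contradiction (trans (≡-sym (iso y)) e) false≢true) , λ 0≢0 → contradiction refl 0≢0
    C′ (suc x) zero _ _ _ =
      (λ e → contradiction (trans (≡-sym (trans (a-sym (suc x) zero) (iso x))) e) false≢true) ,
      λ 0≢0 → contradiction refl 0≢0
    C′ (suc x) (suc y) ix iy x≢y =
      (λ e → contradiction (Fin1-unique _ _) (proj₁ (C x y ix iy (x≢y ∘ cong suc)) e)) ,
      λ 0≢0 → contradiction refl 0≢0
    D′ : ∀ x y → _ → _ → _ → _
    D′ (suc x) (suc y) ix iy x≢y = D x y ix iy (x≢y ∘ cong suc)

  dominating-into-A : ∀ {k} → (∀ i → a zero (suc i) ≡ true) →
    PolarAdj ∞ (fin (suc k)) (a on suc) → PolarAdj ∞ (fin (suc k)) a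
  dominating-into-A dom (inA , (c , C) , (d , D)) =
    true ∷ inA , (0 ∷ (suc ∘ c) , C′) , (zero ∷ d , D′)
    where
    C′ : ∀ x y → _ → _ → _ → _
    C′ zero zero _ _ 0≢0 = contradiction refl 0≢0
    C′ zero (suc y) _ _ _ = (λ _ ()) , λ _ → dom y
    C′ (suc x) zero _ _ _ = (λ _ ()) , λ _ → trans (a-sym (suc x) zero) (dom x)
    C′ (suc x) (suc y) ix iy x≢y = let (p , q) = C x y ix iy (x≢y ∘ cong suc) in
      (λ e → p e ∘ ℕ.suc-injective) , λ ne → q (ne ∘ cong suc)
    D′ : ∀ x y → _ → _ → _ → _
    D′ (suc x) (suc y) ix iy x≢y = D x y ix iy (x≢y ∘ cong suc)

-- The side off `r` goes entirely into A. Across the join all edges are present, so parts from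
-- different sides must stay distinct: labels on side `r` are made even, the others odd.
join-polar : ∀ {k} {X : Set} {h : Adjacency X} (p : X → Bool) (r : Bool) →
  (∀ u w → p u ≢ p w → h u w ≡ true) →
  (c : X → ℕ) →
  (∀ u w → p u ≢ r → p w ≢ r → u ≢ w → (h u w ≡ true → c u ≢ c w) × (c u ≢ c w → h u w ≡ true)) →
  PolarAdj ∞ (fin (suc k)) {Σ X λ u → p u ≡ r} (h on proj₁) → PolarAdj ∞ (fin (suc k)) h
join-polar {k} {X} {h} p r cross c₀ C₀ (inA , (c , C) , (d , D)) =
  (λ u → inA′ u (p u Bool.≟ r)) ,
  ((λ u → c′ u (p u Bool.≟ r)) , λ u w → C′ u w (p u Bool.≟ r) (p w Bool.≟ r)) ,
  ((λ u → d′ u (p u Bool.≟ r)) , λ u w → D′ u w (p u Bool.≟ r) (p w Bool.≟ r))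
  where
  inA′ : ∀ u → Dec (p u ≡ r) → Bool
  inA′ u (yes e) = inA (u , e)
  inA′ u (no _)  = true

  c′ : ∀ u → Dec (p u ≡ r) → ℕ
  c′ u (yes e) = 2 * c (u , e)
  c′ u (no _)  = suc (2 * c₀ u)

  d′ : ∀ u → Dec (p u ≡ r) → Fin (suc k)
  d′ u (yes e) = d (u , e)
  -- A default: such vertices lie in A, so this label is never compared.
  d′ u (no _)  = zero

  C′ : ∀ u w (s : Dec (p u ≡ r)) (t : Dec (p w ≡ r)) → inA′ u s ≡ true → inA′ w t ≡ true → u ≢ w →
    (h u w ≡ true → c′ u s ≢ c′ w t) × (c′ u s ≢ c′ w t → h u w ≡ true)
  C′ u w (yes e) (yes f) iu iw u≢w = let (x , y) = C (u , e) (w , f) iu iw (u≢w ∘ cong proj₁) in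
    (λ uw → x uw ∘ ℕ.*-cancelˡ-≡ _ _ 2) , λ ne → y (ne ∘ cong (2 *_))
  C′ u w (yes e) (no f) _ _ _ =
    (λ _ → ℕ.even≢odd (c (u , e)) (c₀ w)) , λ _ → cross u w λ g → f (trans (≡-sym g) e)
  C′ u w (no e) (yes f) _ _ _ =
    (λ _ → ℕ.even≢odd (c (w , f)) (c₀ u) ∘ ≡-sym) , λ _ → cross u w λ g → e (trans g f)
  C′ u w (no e) (no f) _ _ u≢w = let (x , y) = C₀ u w e f u≢w in
    (λ uw → x uw ∘ ℕ.*-cancelˡ-≡ _ _ 2 ∘ ℕ.suc-injective) , λ ne → y (ne ∘ cong (λ l → suc (2 * l)))

  D′ : ∀ u w (s : Dec (p u ≡ r)) (t : Dec (p w ≡ r)) → inA′ u s ≡ false → inA′ w t ≡ false → u ≢ w →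
    (h u w ≡ true → d′ u s ≡ d′ w t) × (d′ u s ≡ d′ w t → h u w ≡ true)
  D′ u w (yes e) (yes f) iu iw u≢w = D (u , e) (w , f) iu iw (u≢w ∘ cong proj₁)

-- Cographs

-- Injectivity of the map is not demanded: distinct vertices of P₄ have distinct neighbourhoods, so
-- it is automatic.
P₄-free : {X : Set} → Adjacency X → Set
P₄-free {X} a = (f : Fin 4 → X) → ¬ (∀ i j → a (f i) (f j) ≡ P₄adj i j)

P₄-neighbour : ∀ i → ∃[ j ] P₄adj i j ≡ true
P₄-neighbour 0F = 1F , refl
P₄-neighbour 1F = 0F , refl
P₄-neighbour 2F = 1F , refl
P₄-neighbour 3F = 2F , refl

P₄-non-neighbour : ∀ i → ∃[ j ] (i ≢ j × P₄adj i j ≡ false)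
P₄-non-neighbour 0F = 2F , (λ ()) , refl
P₄-non-neighbour 1F = 3F , (λ ()) , refl
P₄-non-neighbour 2F = 0F , (λ ()) , refl
P₄-non-neighbour 3F = 0F , (λ ()) , refl

P₄-twin-free : ∀ i j → (∀ k → P₄adj i k ≡ P₄adj j k) → i ≡ j
P₄-twin-free 0F 0F e = refl
P₄-twin-free 0F 1F e = contradiction (e 0F) λ ()
P₄-twin-free 0F 2F e = contradiction (e 3F) λ ()
P₄-twin-free 0F 3F e = contradiction (e 1F) λ ()
P₄-twin-free 1F 0F e = contradiction (e 0F) λ ()
P₄-twin-free 1F 1F e = refl
P₄-twin-free 1F 2F e = contradiction (e 0F) λ ()
P₄-twin-free 1F 3F e = contradiction (e 0F) λ ()
P₄-twin-free 2F 0F e = contradiction (e 3F) λ ()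
P₄-twin-free 2F 1F e = contradiction (e 0F) λ ()
P₄-twin-free 2F 2F e = refl
P₄-twin-free 2F 3F e = contradiction (e 1F) λ ()
P₄-twin-free 3F 0F e = contradiction (e 1F) λ ()
P₄-twin-free 3F 1F e = contradiction (e 0F) λ ()
P₄-twin-free 3F 2F e = contradiction (e 1F) λ ()
P₄-twin-free 3F 3F e = refl

P₄-map-injective : {X : Set} {a : Adjacency X} (f : Fin 4 → X) →
  (∀ i j → a (f i) (f j) ≡ P₄adj i j) → Injective _≡_ _≡_ f
P₄-map-injective {a = a} f e {i} {j} fi≡fj = P₄-twin-free i j λ k →
  trans (≡-sym (e i k)) (trans (cong (λ x → a x (f k)) fi≡fj) (e j k))

cograph⇒P₄-free : ∀ {G} → Cograph G → P₄-free (adj G)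
cograph⇒P₄-free {G} cog f e = cog (mk↣ (P₄-map-injective {a = adj G} f e) , e)

P₄-free⇒cograph : ∀ {G} → P₄-free (adj G) → Cograph G
P₄-free⇒cograph free (f , e) = free (Injection.to f) e

P₄-free-embed : {X Y : Set} {a : Adjacency X} {b : Adjacency Y} (f : Y → X) →
  (∀ x y → a (f x) (f y) ≡ b x y) → P₄-free a → P₄-free b
P₄-free-embed f e free g p = free (f ∘ g) λ i j → trans (e (g i) (g j)) (p i j)

no-induced-path : {X : Set} {a : Adjacency X} →
  (∀ x y → a x y ≡ a y x) → (∀ x → a x x ≡ false) → P₄-free a →
  ∀ w u z t → a w u ≡ true → a u z ≡ true → a z t ≡ true →
  a w z ≡ false → a w t ≡ false → a u t ≡ false → ⊥
no-induced-path {a = a} a-sym irr free w u z t wu uz zt wz wt ut = free f e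
  where
  f = w ∷ u ∷ z ∷ t ∷ []
  e : ∀ i j → a (f i) (f j) ≡ P₄adj i j
  e 0F 0F = irr w
  e 0F 1F = wu
  e 0F 2F = wz
  e 0F 3F = wt
  e 1F 0F = trans (a-sym u w) wu
  e 1F 1F = irr u
  e 1F 2F = uz
  e 1F 3F = ut
  e 2F 0F = trans (a-sym z w) wz
  e 2F 1F = trans (a-sym z u) uz
  e 2F 2F = irr z
  e 2F 3F = zt
  e 3F 0F = trans (a-sym t w) wt
  e 3F 1F = trans (a-sym t u) ut
  e 3F 2F = trans (a-sym t z) zt
  e 3F 3F = irr t

-- For c = true this is the same fact in the complement: P₄ is self-complementary.
no-monochromatic-path : {X : Set} {a : Adjacency X} →
  (∀ x y → a x y ≡ a y x) → (∀ x → a x x ≡ false) → P₄-free a → (c : Bool) →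
  ∀ w u z t → a w u ≡ not c → a u z ≡ not c → a z t ≡ not c →
  a w z ≡ c → a w t ≡ c → a u t ≡ c → ⊥
no-monochromatic-path a-sym irr free false = no-induced-path a-sym irr free
no-monochromatic-path a-sym irr free true w u z t wu uz zt wz wt ut =
  -- The complement of the path w, u, z, t is the path u, t, w, z.
  no-induced-path a-sym irr free u t w z ut (trans (a-sym t w) wt) wz
    (trans (a-sym u w) wu) uz (trans (a-sym t z) zt)

-- A disjoint union of two non-empty graphs for `colour` false, a join for `colour` true. A single
-- record lets one induction treat a graph and its complement alike.
record Splitting {X : Set} (a : Adjacency X) : Set where
  constructor splitting
  field
    colour  : Bool
    side    : X → Bool
    left    : ∃[ s ] side s ≡ true
    right   : ∃[ t ] side t ≡ false
    uniform : ∀ u w → side u ≡ true → side w ≡ false → a u w ≡ colour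

≢not : ∀ {x c} → x ≢ not c → x ≡ c
≢not {false} {false} _ = refl
≢not {true}  {true}  _ = refl
≢not {false} {true}  n = contradiction refl n
≢not {true}  {false} n = contradiction refl n

-- Extend a splitting (P, Q) of the graph without vertex 0 to the whole graph. Call u a
-- neighbour of 0 if its adjacency to 0 is not the colour c. If P or Q has no neighbour, 0
-- joins the other side. Otherwise no neighbour is c̄-adjacent to a non-neighbour (this
-- would give a path), so the non-neighbours split off; if there are none, 0 splits off.
cograph-splitting : ∀ m {a : Adjacency (Fin (suc (suc m)))} →
  (∀ x y → a x y ≡ a y x) → (∀ x → a x x ≡ false) → P₄-free a → Splitting a
cograph-splitting zero {a} a-sym irr free = splitting (a 0F 1F) (true ∷ (λ _ → false))
  (0F , refl) (1F , refl) λ { 0F 1F _ _ → refl }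
cograph-splitting (suc m) {a} a-sym irr free
  with cograph-splitting m {a on suc} (λ x y → a-sym (suc x) (suc y)) (irr ∘ suc)
         (P₄-free-embed {a = a} suc (λ _ _ → refl) free)
... | splitting c p (s , ps) (t , pt) cross
  with any? (λ i → (p i Bool.≟ true) ×-dec (a zero (suc i) Bool.≟ not c))
     | any? (λ i → (p i Bool.≟ false) ×-dec (a zero (suc i) Bool.≟ not c))
     | any? (λ i → a zero (suc i) Bool.≟ c)
... | no none | _ | _ = splitting c (false ∷ p) (suc s , ps) (suc t , pt) λ
  { (suc u) zero pu _ → trans (a-sym _ _) (≢not λ e → none (u , pu , e))
  ; (suc u) (suc w) pu pw → cross u w pu pw }
... | yes _ | no none | _ = splitting c (true ∷ p) (suc s , ps) (suc t , pt) λ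
  { zero (suc w) _ pw → ≢not λ e → none (w , pw , e)
  ; (suc u) (suc w) pu pw → cross u w pu pw }
... | yes _ | yes _ | no none = splitting (not c) (true ∷ (λ _ → false)) (zero , refl) (suc s , refl) λ
  { zero (suc w) _ _ → ¬-not λ e → none (w , e) }
... | yes (i , pi , zi) | yes (j , pj , zj) | yes (l , zl) =
  splitting c (false ∷ non-neighbour) (suc l , l-left) (zero , refl) uniform
  where
  non-neighbour : Fin _ → Bool
  non-neighbour x = does (a zero (suc x) Bool.≟ c)

  l-left : non-neighbour l ≡ true
  l-left with a zero (suc l) Bool.≟ c
  ... | yes _ = refl
  ... | no ne = contradiction zl ne

  is-non-neighbour : ∀ x → non-neighbour x ≡ true → a zero (suc x) ≡ c
  is-non-neighbour x e with a zero (suc x) Bool.≟ c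
  ... | yes y = y

  is-neighbour : ∀ x → non-neighbour x ≡ false → a zero (suc x) ≡ not c
  is-neighbour x e with a zero (suc x) Bool.≟ c
  ... | no ne = ¬-not ne

  -- Here `x` is a neighbour of 0 on the side opposite to `u` and `w`. If `u` and `w` had colour
  -- `not c`, then `u`, `w`, 0, `x` would be a path in that colour.
  no-path : ∀ u w x → a zero (suc u) ≡ c → a zero (suc w) ≡ not c → a zero (suc x) ≡ not c →
    a (suc u) (suc x) ≡ c → a (suc w) (suc x) ≡ c → a (suc u) (suc w) ≡ c
  no-path u w x zu zw zx ux wx = ≢not λ uw →
    no-monochromatic-path a-sym irr free c (suc u) (suc w) zero (suc x)
      uw (trans (a-sym _ _) zw) zx (trans (a-sym _ _) zu) ux wx

  uniform : ∀ u w → (false ∷ non-neighbour) u ≡ true → (false ∷ non-neighbour) w ≡ false → a u w ≡ c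
  uniform (suc u) zero eu _ = trans (a-sym _ _) (is-non-neighbour u eu)
  uniform (suc u) (suc w) eu ew with p u in pu | p w in pw
  ... | true  | false = cross u w pu pw
  ... | false | true  = trans (a-sym _ _) (cross w u pw pu)
  ... | true  | true  = no-path u w j (is-non-neighbour u eu) (is-neighbour w ew) zj
    (cross u j pu pj) (cross w j pw pj)
  ... | false | false = no-path u w i (is-non-neighbour u eu) (is-neighbour w ew) zi
    (trans (a-sym _ _) (cross i u pi pu)) (trans (a-sym _ _) (cross i w pi pw))

cograph-splitting′ : ∀ {n} {a : Adjacency (Fin n)} →
  (∀ x y → a x y ≡ a y x) → (∀ x → a x x ≡ false) → P₄-free a →
  (x y : Fin n) → x ≢ y → Splitting a
cograph-splitting′ {suc zero} _ _ _ zero zero x≢y = contradiction refl x≢y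
cograph-splitting′ {suc (suc n)} a-sym irr free _ _ _ = cograph-splitting n a-sym irr free

splitting-uniform : {X : Set} {a : Adjacency X} → (∀ x y → a x y ≡ a y x) →
  (s : Splitting a) → let open Splitting s in ∀ u w → side u ≢ side w → a u w ≡ colour
splitting-uniform a-sym s u w ne with Splitting.side s u in pu | Splitting.side s w in pw
... | true  | false = Splitting.uniform s u w pu pw
... | false | true  = trans (a-sym u w) (Splitting.uniform s w u pw pu)
... | true  | true  = contradiction refl ne
... | false | false = contradiction refl ne

-- Vertex-deleted subgraphs and minimality

-- Minimality in a usable form: a subgraph is proper because it omits a named vertex, so its
-- vertices need not be counted.
DeletionPolar : ℕ → ∀ {n} → Adjacency (Fin n) → Set₁
DeletionPolar k {n} a = {Y : Set} (g : Y → Fin n) → Injective _≡_ _≡_ g →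
  (y : Fin n) → (∀ i → g i ≢ y) → PolarAdj ∞ (fin k) (a on g)

polar-omitting : ∀ {s k n} {a : Adjacency (Fin (suc n))} (y : Fin (suc n)) →
  PolarAdj s k (a on punchIn y) →
  {Y : Set} (g : Y → Fin (suc n)) → Injective _≡_ _≡_ g → (∀ i → g i ≢ y) → PolarAdj s k (a on g)
polar-omitting {a = a} y P g inj omit =
  polar-embed (λ i → punchOut (omit i ∘ ≡-sym))
    (λ e → inj (punchOut-injective (omit _ ∘ ≡-sym) (omit _ ∘ ≡-sym) e))
    (λ i j → cong₂ a (punchIn-punchOut _) (punchIn-punchOut _)) P

-- If every vertex were hit, choosing preimages would inject `Fin n` into `Fin m`.
omitted-vertex : ∀ {m n} (f : Fin m → Fin n) → m < n → ∃[ y ] (∀ i → f i ≢ y)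
omitted-vertex {m} {n} f m<n =
  let (y , miss) = ¬∀⟶∃¬ n (λ y → ∃[ i ] f i ≡ y) (λ y → any? λ i → f i ≟ y) not-onto
  in y , λ i e → miss (i , e)
  where
  not-onto : ¬ (∀ y → ∃[ i ] f i ≡ y)
  not-onto onto = ℕ.<⇒≱ m<n (injective⇒≤ {f = proj₁ ∘ onto} λ {x} {y} e →
    trans (≡-sym (proj₂ (onto x))) (trans (cong f e) (proj₂ (onto y))))

minimal⇒deletion-polar : ∀ {k} (G : Graph) →
  (∀ {m} (f : Fin m ↣ V G) → m < n G → Polar ∞ (fin k) (induced G f)) → DeletionPolar k (adj G)
minimal⇒deletion-polar G@record { n = suc m } minimal g inj y =
  polar-omitting {a = adj G} y (minimal (mk↣ (punchIn-injective y _ _)) ℕ.≤-refl) g inj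

deletion-polar⇒minimal : ∀ {k} (G : Graph) → DeletionPolar k (adj G) →
  ∀ {m} (f : Fin m ↣ V G) → m < n G → Polar ∞ (fin k) (induced G f)
deletion-polar⇒minimal G del f m<n = let (y , omit) = omitted-vertex (Injection.to f) m<n in
  del (Injection.to f) (Injection.injective f) y omit

-- Transport along isomorphisms

obstruction-≅ : ∀ {k} (G H : Graph) → G ≅ H →
  CographMinimalObstruction ∞ (fin k) H → CographMinimalObstruction ∞ (fin k) G
obstruction-≅ G H (φ , e) (cog , np , minimal) =
  P₄-free⇒cograph {G} (P₄-free-embed {a = adj H} to e (cograph⇒P₄-free {H} cog)) ,
  (λ P → np (polar-embed from from-inj
    (λ x y → trans (≡-sym (e _ _)) (cong₂ (adj H) (Inverse.strictlyInverseˡ φ x) (Inverse.strictlyInverseˡ φ y))) P)) ,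
  deletion-polar⇒minimal G λ g inj y omit →
    polar-embed {a = adj H on (to ∘ g)} (λ x → x) (λ q → q) (λ x y → e _ _)
      (minimal⇒deletion-polar H minimal (to ∘ g) (inj ∘ to-inj) (to y) λ i q → omit i (to-inj q))
  where
  open Inverse φ using (to; from)
  to-inj : Injective _≡_ _≡_ to
  to-inj = Injection.injective (↔⇒↣ φ)
  from-inj : Injective _≡_ _≡_ from
  from-inj = Injection.injective (↔⇒↣ (↔-sym φ))

Labelling : {X : Set} → Adjacency X → Graph → Set
Labelling {X} a H = Σ (V H ↔ X) λ φ →
  ∀ u w → a (Inverse.to φ u) (Inverse.to φ w) ≡ adj H u w

labelling⇒≅ : ∀ {m} (G H : Graph) (π : Fin m ↔ V G) → Labelling (adj G on Inverse.to π) H → G ≅ H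
labelling⇒≅ G H π (ρ , ρ-adj) = ↔-sym φ , λ u w →
  trans (≡-sym (ρ-adj (from u) (from w)))
    (cong₂ (adj G) (strictlyInverseˡ u) (strictlyInverseˡ w))
  where
  φ = ρ ∘ₚ π
  open Inverse φ using (from; strictlyInverseˡ)

-- Minimal obstructions with an isolated vertex

module _ {j m : ℕ} {a : Adjacency (Fin (suc (suc m)))}
  (a-sym : ∀ x y → a x y ≡ a y x) (irr : ∀ x → a x x ≡ false) (iso : ∀ i → a zero i ≡ false)
  -- Connectedness of the graph without 0 is phrased through cuts, the form that a `Splitting` of
  -- colour `false` contradicts directly.
  (connected : ∀ (p : Fin (suc m) → Bool) → (∀ u w → p u ≢ p w → a (suc u) (suc w) ≡ false) →
    ∀ u w → p u ≡ p w)
  (free : P₄-free a)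
  (not-polar : ¬ PolarAdj ∞ (fin (suc (suc j))) a)
  (del : DeletionPolar (suc (suc j)) a)
  where

  private
    h : Adjacency (Fin (suc m))
    h = a on suc

    h-sym : ∀ x y → h x y ≡ h y x
    h-sym x y = a-sym (suc x) (suc y)

    h-not-polar : ¬ PolarAdj ∞ (fin (suc j)) h
    h-not-polar = not-polar ∘ isolated-into-B a-sym (iso ∘ suc)

    h-polar : PolarAdj ∞ (fin (suc (suc j))) h
    h-polar = del suc suc-injective zero (λ _ ())

    inA = proj₁ h-polar
    c   = proj₁ (proj₁ (proj₂ h-polar))
    C   = proj₂ (proj₁ (proj₂ h-polar))
    d   = proj₁ (proj₂ (proj₂ h-polar))
    D   = proj₂ (proj₂ (proj₂ h-polar))

    abstract
      -- Otherwise B is a clique, one label suffices for it, and `h` is (∞, j+1)-polar.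
      two-cliques : ∃[ x ] ∃[ y ] (inA x ≡ false × inA y ≡ false × x ≢ y × h x y ≡ false)
      two-cliques with any? (λ x → any? (λ y →
        (inA x Bool.≟ false) ×-dec (inA y Bool.≟ false) ×-dec ¬? (x ≟ y) ×-dec (h x y Bool.≟ false)))
      ... | yes found = found
      ... | no none = contradiction
        (inA , (c , C) , ((λ _ → zero) , λ x y ix iy x≢y →
          (λ _ → refl) , λ _ → ¬-not λ e → none (x , y , ix , iy , x≢y , e)))
        h-not-polar

    b₁ = proj₁ two-cliques
    b₂ = proj₁ (proj₂ two-cliques)
    b₁∈B = proj₁ (proj₂ (proj₂ two-cliques))
    b₂∈B = proj₁ (proj₂ (proj₂ (proj₂ two-cliques)))
    b₁≢b₂ = proj₁ (proj₂ (proj₂ (proj₂ (proj₂ two-cliques))))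
    b₁≁b₂ = proj₂ (proj₂ (proj₂ (proj₂ (proj₂ two-cliques))))

    -- Together with 0 and `x`, the image of `g` induces a graph K₁ + (K₁ ⊕ Y) that omits `y`, hence
    -- is polar by minimality. Stripping the isolated vertex, and then the dominating one, leaves
    -- the claim.
    neighbours-polar : ∀ x y → x ≢ y → {Y : Set} (g : Y → Fin (suc m)) → Injective _≡_ _≡_ g →
      (∀ i → h x (g i) ≡ true) → (∀ i → g i ≢ y) → PolarAdj ∞ (fin (suc j)) (h on g)
    neighbours-polar x y x≢y {Y} g g-inj dom omit
      with isolated-split {a = a on f} nothing just just-injective (λ _ ()) (λ i → iso (f (just i)))
             (del f f-injective (suc y) f-omits)
      where
      f : Maybe (Maybe Y) → Fin (suc (suc m))
      -- `nothing` stands for the isolated vertex, `just nothing` for the dominating vertex `x`.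
      f nothing = zero
      f (just nothing) = suc x
      f (just (just i)) = suc (g i)

      x≢g : ∀ i → x ≢ g i
      x≢g i e = false≢true (trans (≡-sym (irr (suc x))) (trans (cong (h x) e) (dom i)))

      f-injective : Injective _≡_ _≡_ f
      f-injective {nothing} {nothing} _ = refl
      f-injective {just nothing} {just nothing} _ = refl
      f-injective {just nothing} {just (just i)} e = contradiction (suc-injective e) (x≢g i)
      f-injective {just (just i)} {just nothing} e = contradiction (≡-sym (suc-injective e)) (x≢g i)
      f-injective {just (just i)} {just (just i′)} e = cong (just ∘ just) (g-inj (suc-injective e))
      f-injective {nothing} {just nothing} ()
      f-injective {nothing} {just (just _)} ()
      f-injective {just nothing} {nothing} ()
      f-injective {just (just _)} {nothing} ()

      f-omits : ∀ i → f i ≢ suc y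
      f-omits (just nothing) e = x≢y (suc-injective e)
      f-omits (just (just i)) e = omit i (suc-injective e)
    ... | inj₁ P = polar-restrict just just-injective P
    ... | inj₂ P = dominating-split nothing just just-injective (λ _ ()) dom (toℕ ∘ g) (g-inj ∘ toℕ-injective) P

    module _ (p : Fin (suc m) → Bool) (cross : ∀ u w → p u ≢ p w → h u w ≡ true) where

      -- The non-adjacent `b₁` and `b₂` lie on one side. A vertex of B on the other side would be
      -- adjacent to both and so put them in the same clique.
      B-one-sided : ∀ u → inA u ≡ false → p u ≡ p b₁
      B-one-sided u u∈B = decidable-stable (p u Bool.≟ p b₁) λ ne →
        let b₂-side : p b₁ ≡ p b₂
            b₂-side = decidable-stable (p b₁ Bool.≟ p b₂) λ ne′ →
              false≢true (trans (≡-sym b₁≁b₂) (cross b₁ b₂ ne′))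
            ne₂ : p u ≢ p b₂
            ne₂ e = ne (trans e (≡-sym b₂-side))
            e₁ = proj₁ (D u b₁ u∈B b₁∈B (ne ∘ cong p)) (cross u b₁ ne)
            e₂ = proj₁ (D u b₂ u∈B b₂∈B (ne₂ ∘ cong p)) (cross u b₂ ne₂)
        in false≢true (trans (≡-sym b₁≁b₂)
             (proj₂ (D b₁ b₂ b₁∈B b₂∈B b₁≢b₂) (trans (≡-sym e₁) e₂)))

      -- K₁ + ({x} ⊕ side of b₁) is already an obstruction, so it is everything.
      other-side-unique : ∀ x y → p x ≢ p b₁ → p y ≢ p b₁ → x ≡ y
      other-side-unique x y px py = decidable-stable (x ≟ y) λ x≢y →
        -- The side without `b₁` lies in A, hence is complete multipartite. The side of `b₁` lies in
        -- the neighbourhood of `x` and misses `y`, hence is (∞, j+1)-polar.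
        h-not-polar (join-polar p (p b₁) cross c
          (λ u w pu pw → C u w (¬-not (pu ∘ B-one-sided u)) (¬-not (pw ∘ B-one-sided w)))
          (neighbours-polar x y x≢y proj₁ proj₁-injective
            (λ (u , e) → cross x u λ q → px (trans q e))
            (λ (u , e) u≡y → py (trans (cong p (≡-sym u≡y)) e))))
        where
        proj₁-injective : Injective {A = Σ (Fin (suc m)) λ u → p u ≡ p b₁} _≡_ _≡_ proj₁
        proj₁-injective {u , e} {_ , f} refl = cong (u ,_) (uip e f)

    abstract
      -- Connectedness makes the splitting of `h` a join. The side without `b₁` is then a single
      -- vertex, adjacent to all others.
      dominating-vertex : ∃[ x ] (x ≢ b₁ × x ≢ b₂ × ∀ i → h x (punchIn x i) ≡ true)
      dominating-vertex
        with cograph-splitting′ {a = h} h-sym (irr ∘ suc) (P₄-free-embed {a = a} suc (λ _ _ → refl) free) b₁ b₂ b₁≢b₂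
      ... | S@(splitting false p (s , ps) (t , pt) _) = contradiction
        (trans (≡-sym pt) (trans (connected p (splitting-uniform h-sym S) t s) ps)) false≢true
      ... | S@(splitting true p (s , ps) (t , pt) _) = found (opposite (p b₁) refl)
        where
        cross : ∀ u w → p u ≢ p w → h u w ≡ true
        cross = splitting-uniform h-sym S

        opposite : ∀ b → p b₁ ≡ b → ∃[ x ] p x ≢ p b₁
        opposite true  e = t , λ q → false≢true (trans (≡-sym pt) (trans q e))
        opposite false e = s , λ q → false≢true (trans (≡-sym e) (trans (≡-sym q) ps))

        found : ∃[ x ] p x ≢ p b₁ → ∃[ x ] (x ≢ b₁ × x ≢ b₂ × ∀ i → h x (punchIn x i) ≡ true)
        found (x , px) = x ,
          (px ∘ cong p) ,
          (λ x≡b₂ → px (trans (cong p x≡b₂) (B-one-sided p cross b₂ b₂∈B))) ,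
          λ i → cross x (punchIn x i) λ e → punchInᵢ≢i x i
            (other-side-unique p cross _ _ (px ∘ trans e) px)

    x = proj₁ dominating-vertex
    x≢b₁ = proj₁ (proj₂ dominating-vertex)
    x≢b₂ = proj₁ (proj₂ (proj₂ dominating-vertex))
    x-dom = proj₂ (proj₂ (proj₂ dominating-vertex))

    h′ : Adjacency (Fin m)
    h′ = h on punchIn x

    h′-sym : ∀ u w → h′ u w ≡ h′ w u
    h′-sym u w = h-sym (punchIn x u) (punchIn x w)

    h′-free : P₄-free h′
    h′-free = P₄-free-embed {a = a} (suc ∘ punchIn x) (λ _ _ → refl) free

    c₁ c₂ : Fin m
    c₁ = punchOut x≢b₁
    c₂ = punchOut x≢b₂

    -- A join decomposition of `h′` extends to `h` with `x` placed opposite to `b₁`. By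
    -- `other-side-unique` that side holds nothing besides `x`.
    no-join : (q : Fin m → Bool) → (∀ u w → q u ≢ q w → h′ u w ≡ true) → ∀ i → q i ≡ q c₁
    no-join q cross i = decidable-stable (q i Bool.≟ q c₁) λ ne →
      punchInᵢ≢i x i (other-side-unique q′ cross′ (punchIn x i) x
        (λ e → ne (trans (≡-sym (q′-punchIn i)) (trans e q′-b₁)))
        (λ e → not-¬ refl (trans (≡-sym q′-b₁) (trans (≡-sym e) (insertAt-lookup q x _)))))
      where
      q′ : Fin (suc m) → Bool
      q′ = insertAt q x (not (q c₁))

      q′-punchIn : ∀ i → q′ (punchIn x i) ≡ q i
      q′-punchIn = insertAt-punchIn q x _

      q′-b₁ : q′ b₁ ≡ q c₁
      q′-b₁ = trans (cong q′ (≡-sym (punchIn-punchOut x≢b₁))) (q′-punchIn c₁)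

      cross′ : ∀ u w → q′ u ≢ q′ w → h u w ≡ true
      cross′ u w ne with x ≟ u | x ≟ w
      ... | yes refl | yes refl = contradiction refl ne
      ... | yes refl | no x≢w = trans (cong (h x) (≡-sym (punchIn-punchOut x≢w))) (x-dom _)
      ... | no x≢u | yes refl = trans (h-sym u x) (trans (cong (h x) (≡-sym (punchIn-punchOut x≢u))) (x-dom _))
      ... | no x≢u | no x≢w = trans (≡-sym (cong₂ h (punchIn-punchOut x≢u) (punchIn-punchOut x≢w)))
        (cross _ _ λ e → ne
          (trans (cong q′ (≡-sym (punchIn-punchOut x≢u)))
          (trans (q′-punchIn _) (trans e (trans (≡-sym (q′-punchIn _))
          (cong q′ (punchIn-punchOut x≢w)))))))

    H′ : Graph
    H′ = record { n = m ; adj = h′ ; sym = h′-sym ; irrefl = λ i → irr (suc (punchIn x i)) }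

    -- By `no-join` the splitting of H′ is a disjoint union, and a walk cannot leave its side.
    H′-disconnected : Disconnected H′
    H′-disconnected with cograph-splitting′ {a = h′} h′-sym (irrefl H′) h′-free c₁ c₂
                           (b₁≢b₂ ∘ punchOut-injective x≢b₁ x≢b₂)
    ... | S@(splitting true q (s , qs) (t , qt) _) = contradiction
      (trans (≡-sym qt) (trans (no-join q cross t) (trans (≡-sym (no-join q cross s)) qs))) false≢true
      where cross = splitting-uniform h′-sym S
    ... | S@(splitting false q (s , qs) (t , qt) uniform) = s , t , separated qs
      where
      separated : ∀ {u} → q u ≡ true → ¬ Reach H′ u t
      separated qu here = false≢true (trans (≡-sym qt) qu)
      separated qu (step {y = w} uw r) with q w in qw
      ... | true  = separated qw r
      ... | false = false≢true (trans (≡-sym (uniform _ w qu qw)) uw)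

    -- Otherwise the dominating `x` could be added to A as a new part, making `h` polar. The
    -- permutation `π` moves `x` to position 0.
    h′-not-polar : ¬ PolarAdj ∞ (fin (suc j)) h′
    h′-not-polar P = h-not-polar (polar-embed {a = a′} from from-inj
      (λ u w → cong₂ h (to∘from u) (to∘from w))
      (dominating-into-A (λ u w → h-sym _ _) x-dom P))
      where
      π = insert zero x Perm.id
      open Inverse π using (to; from)
      a′ = h on to
      from-inj : Injective _≡_ _≡_ from
      from-inj = Injection.injective (↔⇒↣ (↔-sym π))
      to∘from = Inverse.strictlyInverseˡ π

    -- Deleting `x` from the whole graph leaves K₁ + H′, which is polar by minimality;
    -- `h′-not-polar` rules out the first outcome of `isolated-split`.
    H′-polar : Polar (fin 1) (fin (suc (suc j))) H′
    H′-polar with isolated-split {a = a on f} zero suc suc-injective (λ _ ()) (λ i → iso (f (suc i)))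
                    (del f f-injective (suc x) f-omits)
      where
      f : Fin (suc m) → Fin (suc (suc m))
      f = zero ∷ (suc ∘ punchIn x)

      f-injective : Injective _≡_ _≡_ f
      f-injective {zero} {zero} _ = refl
      f-injective {suc i} {suc i′} e = cong suc (punchIn-injective x i i′ (suc-injective e))

      f-omits : ∀ i → f i ≢ suc x
      f-omits (suc i) e = punchInᵢ≢i x i (suc-injective e)
    ... | inj₁ P = contradiction P h′-not-polar
    ... | inj₂ P = P

    -- For minimality: a proper subgraph of H′ lies in the neighbourhood of `x` and omits a vertex,
    -- so `neighbours-polar` applies.
    H′-obstruction : CographMinimalObstruction ∞ (fin (suc j)) H′
    H′-obstruction = P₄-free⇒cograph {H′} h′-free , h′-not-polar ,
      deletion-polar⇒minimal H′ λ g g-inj y omit →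
        neighbours-polar x (punchIn x y) (punchInᵢ≢i x y ∘ ≡-sym) (punchIn x ∘ g)
          (g-inj ∘ punchIn-injective x _ _) (x-dom ∘ g) (λ i → omit i ∘ punchIn-injective x _ _)

    labelling : Labelling a (K₁ +ᴳ (K₁ ⊕ H′))
    -- This sends 0 to the isolated vertex, 1 to `x`, and the rest to H′ in order.
    labelling = lift₀ (insert zero x Perm.id) , e
      where
      to = Inverse.to (lift₀ (insert zero x Perm.id))
      e : ∀ u w → a (to u) (to w) ≡ adj (K₁ +ᴳ (K₁ ⊕ H′)) u w
      e zero zero = iso _
      e zero (suc zero) = iso _
      e zero (suc (suc w)) = iso _
      e (suc zero) zero = trans (a-sym _ _) (iso _)
      e (suc (suc u)) zero = trans (a-sym _ _) (iso _)
      e (suc zero) (suc zero) = irr _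
      e (suc zero) (suc (suc w)) = x-dom w
      e (suc (suc u)) (suc zero) = trans (a-sym _ _) (x-dom u)
      e (suc (suc u)) (suc (suc w)) = refl

  abstract
    isolated-obstruction : ∃[ H ] (Disconnected H × CographMinimalObstruction ∞ (fin (suc j)) H
      × Polar (fin 1) (fin (suc (suc j))) H × Labelling a (K₁ +ᴳ (K₁ ⊕ H)))
    isolated-obstruction = H′ , H′-disconnected , H′-obstruction , H′-polar , labelling

-- From two components to an isolated vertex at position 0

reach-invariant : ∀ {G x y} (p : V G → Bool) → (∀ u w → Adj G u w → p u ≡ p w) →
  Reach G x y → p x ≡ p y
reach-invariant p inv here = refl
reach-invariant p inv (step uw r) = trans (inv _ _ uw) (reach-invariant p inv r)

decomposition : ∀ j (G : Graph) → TwoComponentsOneTrivial G →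
  CographMinimalObstruction ∞ (fin (suc (suc j))) G →
  ∃[ H′ ] (Disconnected H′ × CographMinimalObstruction ∞ (fin (suc j)) H′
           × Polar (fin 1) (fin (suc (suc j))) H′ × G ≅ (K₁ +ᴳ (K₁ ⊕ H′)))
decomposition j record { n = suc zero } (zero , _ , (zero , x≢v) , _) _ = contradiction refl x≢v
decomposition j G@record { n = suc (suc m) } (v , iso , _ , reach) (cog , np , minimal) =
  let (H , disconnected , obstruction , polar , labelling) =
        isolated-obstruction a-sym a-irr a-iso a-connected a-free a-not-polar a-del
  in H , disconnected , obstruction , polar , labelling⇒≅ G (K₁ +ᴳ (K₁ ⊕ H)) π labelling
  where
  π = insert zero v Perm.id
  open Inverse π using (to; from; strictlyInverseˡ; strictlyInverseʳ)

  a = adj G on to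

  to-inj : Injective _≡_ _≡_ to
  to-inj = Injection.injective (↔⇒↣ π)

  from-inj : Injective _≡_ _≡_ from
  from-inj = Injection.injective (↔⇒↣ (↔-sym π))

  a-sym : ∀ u w → a u w ≡ a w u
  a-sym u w = sym G (to u) (to w)

  a-irr : ∀ u → a u u ≡ false
  a-irr u = irrefl G (to u)

  a-iso : ∀ i → a zero i ≡ false
  a-iso i = iso (to i)

  a-connected : ∀ (p : Fin (suc m) → Bool) → (∀ u w → p u ≢ p w → a (suc u) (suc w) ≡ false) →
    ∀ u w → p u ≡ p w
  a-connected p cut u w =
    trans (≡-sym (cong p′ (strictlyInverseʳ (suc u))))
    (trans (reach-invariant {G} (p′ ∘ from) invariant
              (reach (to (suc u)) (to (suc w)) (punchInᵢ≢i v u) (punchInᵢ≢i v w)))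
           (cong p′ (strictlyInverseʳ (suc w))))
    where
    p′ : Fin (suc (suc m)) → Bool
    -- The value at the isolated vertex is arbitrary, since no edge meets it.
    p′ = true ∷ p

    a-invariant : ∀ u w → a u w ≡ true → p′ u ≡ p′ w
    a-invariant zero w uw = contradiction (trans (≡-sym (a-iso w)) uw) false≢true
    a-invariant (suc u) zero uw =
      contradiction (trans (≡-sym (trans (a-sym (suc u) zero) (a-iso (suc u)))) uw) false≢true
    a-invariant (suc u) (suc w) uw = decidable-stable (p u Bool.≟ p w) λ ne →
      false≢true (trans (≡-sym (cut u w ne)) uw)

    invariant : ∀ u w → Adj G u w → p′ (from u) ≡ p′ (from w)
    invariant u w uw = a-invariant (from u) (from w)
      (trans (cong₂ (adj G) (strictlyInverseˡ u) (strictlyInverseˡ w)) uw)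

  a-free : P₄-free a
  a-free = P₄-free-embed {a = adj G} to (λ _ _ → refl) (cograph⇒P₄-free {G} cog)

  a-not-polar : ¬ PolarAdj ∞ (fin (suc (suc j))) a
  a-not-polar = np ∘ polar-embed from from-inj
    (λ u w → cong₂ (adj G) (strictlyInverseˡ u) (strictlyInverseˡ w))

  a-del : DeletionPolar (suc (suc j)) a
  a-del g g-inj y omit = minimal⇒deletion-polar G minimal (to ∘ g) (g-inj ∘ to-inj) (to y)
    (λ i → omit i ∘ to-inj)

-- The graph K₁ + (K₁ ⊕ H)

-- Every vertex of P₄ has a neighbour, so an induced P₄ avoids the isolated vertex; every vertex
-- also has a non-neighbour, so it avoids the vertex dominating the rest. It therefore lies in `H`.
isolated-dominating-P₄-free : ∀ H → P₄-free (adj H) → P₄-free (adj (K₁ +ᴳ (K₁ ⊕ H)))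
isolated-dominating-P₄-free H free f e = free (proj₁ ∘ inner) λ i j →
  trans (≡-sym (cong₂ (adj T) (proj₂ (inner i)) (proj₂ (inner j)))) (e i j)
  where
  T = K₁ +ᴳ (K₁ ⊕ H)

  zero-isolated : ∀ y → adj T zero y ≡ false
  zero-isolated zero = refl
  zero-isolated (suc zero) = refl
  zero-isolated (suc (suc _)) = refl

  f≢0 : ∀ i → f i ≢ zero
  f≢0 i fi≡0 = let (j , ij) = P₄-neighbour i in
    false≢true (trans (≡-sym (zero-isolated (f j)))
      (trans (cong (λ u → adj T u (f j)) (≡-sym fi≡0)) (trans (e i j) ij)))

  f≢1 : ∀ i → f i ≢ suc zero
  f≢1 i fi≡1 with P₄-non-neighbour i
  ... | j , i≢j , ij with f j in fj
  ...   | zero = f≢0 j fj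
  ...   | suc zero = i≢j (P₄-map-injective {a = adj T} f e (trans fi≡1 (≡-sym fj)))
  ...   | suc (suc _) = false≢true
    (trans (≡-sym ij) (trans (≡-sym (e i j)) (cong₂ (adj T) fi≡1 fj)))

  inner : ∀ i → ∃[ u ] f i ≡ suc (suc u)
  inner i with f i in fi
  ... | zero = contradiction fi (f≢0 i)
  ... | suc zero = contradiction fi (f≢1 i)
  ... | suc (suc u) = u , refl

-- Without the isolated or the dominating vertex, the (1, j+2)-partition of `H` extends. Without a
-- vertex of `H`, what remains of `H` is (∞, j+1)-polar; the dominating vertex joins A and the
-- isolated one becomes an extra clique.
composition : ∀ j H → CographMinimalObstruction ∞ (fin (suc j)) H →
  Polar (fin 1) (fin (suc (suc j))) H →
  CographMinimalObstruction ∞ (fin (suc (suc j))) (K₁ +ᴳ (K₁ ⊕ H))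
composition j H (cog , np , minimal) H-polar =
  P₄-free⇒cograph {T} (isolated-dominating-P₄-free H (cograph⇒P₄-free {H} cog)) ,
  not-polar ,
  deletion-polar⇒minimal T λ g g-inj y → polar-omitting {a = adj T} y (deleted y) g g-inj
  where
  T = K₁ +ᴳ (K₁ ⊕ H)

  not-polar : ¬ Polar ∞ (fin (suc (suc j))) T
  not-polar P with isolated-split {a = adj T} zero suc suc-injective (λ _ ())
                     (λ { zero → refl ; (suc _) → refl }) P
  ... | inj₁ Q = np (polar-restrict suc suc-injective Q)
  ... | inj₂ Q = np (dominating-split zero suc suc-injective (λ _ ()) (λ _ → refl) toℕ toℕ-injective Q)

  deleted : ∀ y → PolarAdj ∞ (fin (suc (suc j))) (adj T on punchIn y)
  deleted zero = dominating-into-A (λ u w → sym T (suc u) (suc w)) (λ _ → refl) (polar-weaken H-polar)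
  deleted (suc zero) = isolated-into-A (λ u w → sym T (punchIn 1F u) (punchIn 1F w)) (λ _ → refl) H-polar
  deleted (suc (suc y)) = delete-inner H (minimal⇒deletion-polar H minimal) y
    where
    -- Generalising over `H` allows matching on `n = suc _`, which `punchIn y` needs.
    delete-inner : ∀ H → DeletionPolar (suc j) (adj H) → (y : V H) →
      PolarAdj ∞ (fin (suc (suc j))) (adj (K₁ +ᴳ (K₁ ⊕ H)) on punchIn (suc (suc y)))
    delete-inner H@record { n = suc _ } del y =
      isolated-into-B (λ u w → sym (K₁ +ᴳ (K₁ ⊕ H)) (punchIn (suc (suc y)) u) (punchIn (suc (suc y)) w))
        (λ { zero → refl ; (suc _) → refl })
        (dominating-into-A (λ u w → sym (K₁ ⊕ H) (punchIn (suc y) u) (punchIn (suc y) w)) (λ _ → refl)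
          (del (punchIn y) (punchIn-injective y _ _) y (punchInᵢ≢i y)))

theorem7 : (k : ℕ) → 2 ≤ k → (G : Graph) → TwoComponentsOneTrivial G →
    CographMinimalObstruction ∞ (fin k) G ⇔
    (∃[ H′ ] (Disconnected H′ × CographMinimalObstruction ∞ (fin (k ∸ 1)) H′
              × Polar (fin 1) (fin k) H′ × G ≅ (K₁ +ᴳ (K₁ ⊕ H′))))
theorem7 (suc zero) (s≤s ())
theorem7 (suc (suc j)) _ G two = mk⇔ (decomposition j G two)
  λ (H , _ , obstruction , polar , G≅T) → obstruction-≅ G (K₁ +ᴳ (K₁ ⊕ H)) G≅T (composition j H obstruction polar)
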